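{- Let $G$ be a graph with minimum degree at least $2$. If $\chi'_{\mathrm{inj}}(G)=k$, then $\chi_{st}(G)\leq 2^k-1$.
   Context: All graphs are finite and simple. A star coloring of $G$ is a proper vertex coloring of $G$ such that the union of any two color classes induces a star forest in $G$, i.e. every component of the induced subgraph is a star. The star chromatic number $\chi_{st}(G)$ is the smallest integer $k$ for which $G$ admits a star coloring with $k$ colors. Three edges $e_1,e_2,e_3$ of a graph are consecutive if they form (in this order) a path of length three or a cycle of length three. An injective edge-coloring of $G$ with $k$ colors is a map $c:E(G)\to\{1,\dots,k\}$ (not necessarily a proper edge-coloring) such that $c(e_1)\neq c(e_3)$ whenever $e_1,e_2,e_3$ are consecutive edges in $G$. The injective chromatic index $\chi'_{\mathrm{inj}}(G)$ is the minimum $k$ such that $G$ has an injective edge-coloring with $k$ colors. -}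

module Defs where

open import Data.Fin using (Fin; _<_)
open import Data.List using (length; filter; allFin)
open import Data.Nat using (ℕ; _≤_)
open import Data.Product using (_×_; ∃-syntax; Σ-syntax)
open import Data.Refinement using (Refinement; value)
open import Data.Sum using (_⊎_)
open import Function using (_⇔_; _on_)
open import Level using (0ℓ)
open import Relation.Binary using (Rel; Decidable; Symmetric; Irreflexive)
open import Relation.Binary.Construct.Closure.ReflexiveTransitive using (Star)
open import Relation.Binary.PropositionalEquality using (_≡_; _≢_; cong)
open import Relation.Unary using (Pred)

record Graph (V : Set) : Set₁ where
  field
    _~_    : Rel V 0ℓ
    _~?_   : Decidable _~_
    sym    : Symmetric _~_
    irrefl : Irreflexive _≡_ _~_

module _ {V : Set} where

  -- Vertices of an induced subgraph carry an irrelevant membership proof,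
  -- so they are equal exactly when the underlying vertices of G are.
  _[_] : (G : Graph V) (S : Pred V 0ℓ) → Graph (Refinement V S)
  G [ S ] = record
    { _~_    = G._~_ on value
    ; _~?_   = λ x y → value x G.~? value y
    ; sym    = G.sym
    ; irrefl = λ x≡y → G.irrefl (cong value x≡y)
    }
    where module G = Graph G

  -- stdlib's `Star` is the reflexive-transitive closure, unrelated to star graphs.
  Reachable : Graph V → Rel V 0ℓ
  Reachable G = Star (Graph._~_ G)

  component : (G : Graph V) (v : V) → Graph (Refinement V (Reachable G v))
  component G v = G [ Reachable G v ]

-- The stars are the graphs K₁,ₘ with m ≥ 0, so an isolated vertex is a star.
IsStar : {V : Set} → Graph V → Set
IsStar {V} G = Σ[ c ∈ V ] (∀ x y → x ~ y ⇔ ((x ≡ c × y ≢ c) ⊎ (x ≢ c × y ≡ c)))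
  where open Graph G

IsStarForest : {V : Set} → Graph V → Set
IsStarForest G = ∀ v → IsStar (component G v)

IsLeast : Pred ℕ 0ℓ → Pred ℕ 0ℓ
IsLeast P k = P k × (∀ j → P j → k ≤ j)

module _ {n : ℕ} (G : Graph (Fin n)) where
  open Graph G

  degree : Fin n → ℕ
  degree v = length (filter (v ~?_) (allFin n))

  MinDegreeAtLeast : ℕ → Set
  MinDegreeAtLeast d = ∀ v → d ≤ degree v

  IsProperColoring : {k : ℕ} → (Fin n → Fin k) → Set
  IsProperColoring f = ∀ {u v} → u ~ v → f u ≢ f v

  IsStarColoring : {k : ℕ} → (Fin n → Fin k) → Set
  IsStarColoring f =
    IsProperColoring f ×
    (∀ i j → i ≢ j → IsStarForest (G [ (λ v → f v ≡ i ⊎ f v ≡ j) ]))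

  StarColorable : ℕ → Set
  StarColorable k = ∃[ f ] IsStarColoring {k} f

  IsStarChromaticNumber : ℕ → Set
  IsStarChromaticNumber = IsLeast StarColorable

  -- Listing the endpoints in increasing order, with irrelevant proofs, makes
  -- each unordered pair of adjacent vertices exactly one edge.
  record Edge : Set where
    constructor edge
    field
      src tgt   : Fin n
      .src<tgt  : src < tgt
      .adjacent : src ~ tgt

  Joins : Edge → Fin n → Fin n → Set
  Joins e u v = (src ≡ u × tgt ≡ v) ⊎ (src ≡ v × tgt ≡ u)
    where open Edge e

  data Consecutive (e₁ e₂ e₃ : Edge) : Set where
    path  : ∀ {a b c d} →
            a ≢ b → a ≢ c → a ≢ d → b ≢ c → b ≢ d → c ≢ d →
            Joins e₁ a b → Joins e₂ b c → Joins e₃ c d →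
            Consecutive e₁ e₂ e₃
    cycle : ∀ {a b c} →
            a ≢ b → b ≢ c → c ≢ a →
            Joins e₁ a b → Joins e₂ b c → Joins e₃ c a →
            Consecutive e₁ e₂ e₃

  IsInjectiveEdgeColoring : {k : ℕ} → (Edge → Fin k) → Set
  IsInjectiveEdgeColoring c = ∀ {e₁ e₂ e₃} → Consecutive e₁ e₂ e₃ → c e₁ ≢ c e₃

  InjectivelyEdgeColorable : ℕ → Set
  InjectivelyEdgeColorable k = ∃[ c ] IsInjectiveEdgeColoring {k} c

  IsInjectiveChromaticIndex : ℕ → Set
  IsInjectiveChromaticIndex = IsLeast InjectivelyEdgeColorable

{-# OPTIONS --safe #-}

-- Colour each vertex by the set of colours that the injective edge colouring
-- uses on its incident edges; there are at most 2ᵏ - 1 nonempty such sets.  In a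
-- walk w, u, v, x with w ≠ v and u ≠ x the two outer edges have different
-- colours.  If adjacent vertices, or alternate vertices of a path on four
-- vertices, had equal sets, then moving a colour from a vertex to another one
-- with the same set would produce such a walk with equally coloured outer edges.
--
-- A proper colouring is a star colouring exactly when every bicoloured walk of
-- length three backtracks.  This condition does not mention reachability, so it is
-- decidable, and hence the star chromatic number exists constructively.
module Submission where

open import Data.Fin using (Fin; zero; suc; finToFun; funToFin; punchOut)
open import Data.Fin.Properties
  using (_≟_; any?; all?; <-cmp; <-asym; finToFun-funToFin; punchOut-injective)
open import Data.Empty using (⊥-elim-irr)
open import Data.Irrelevant using () renaming ([_] to ⟦_⟧)
open import Data.List using (List; []; _∷_; length; filter; allFin)
open import Data.List.Relation.Unary.All using (All; []; _∷_)
open import Data.List.Relation.Unary.All.Properties using (all-filter)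
open import Data.List.Relation.Unary.AllPairs using ([]; _∷_)
open import Data.List.Relation.Unary.Unique.Propositional using (Unique)
open import Data.List.Relation.Unary.Unique.Propositional.Properties using (allFin⁺; filter⁺)
open import Data.Nat using (ℕ; zero; suc; _≤_; _∸_; _^_; z≤n; s≤s)
open import Data.Product using (_×_; ∃-syntax; ∃; _,_; proj₁; proj₂)
open import Data.Refinement using (Refinement; value; _,_)
open import Data.Refinement.Properties using (value-injective) renaming (_≟_ to ≟-refinement)
open import Data.Sum using (_⊎_; inj₁; inj₂; swap; fromInj₂; map; map₂)
open import Function using (_∘_; mk⇔; Equivalence)
open import Level using (0ℓ)
open import Relation.Binary using (DecidableEquality; tri<; tri≈; tri>)
open import Relation.Binary.Construct.Closure.ReflexiveTransitive using (ε; _◅_)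
open import Relation.Binary.PropositionalEquality
  using (_≡_; _≢_; refl; cong; trans; ≢-sym; _≗_; module ≡-Reasoning)
  renaming (sym to ≡-sym)
open import Relation.Nullary using (Dec; yes; no; ¬_; contradiction)
open import Relation.Nullary.Decidable using (map′; recompute; ¬?; _×-dec_; _⊎-dec_; _→-dec_)
open import Relation.Unary using (Pred; Decidable; _⊆_)
open import Relation.Unary.Properties using (∅?)
open import Defs

-- Finite search and coding of subsets

least : {P : Pred ℕ 0ℓ} → Decidable P → ∀ {m} → P m → ∃[ k ] (IsLeast P k × k ≤ m)
least P? {m} pm with P? zero
... | yes p₀ = zero , (p₀ , λ _ _ → z≤n) , z≤n
least P? {zero}  pm | no ¬p₀ = contradiction pm ¬p₀
least {P} P? {suc m} pm | no ¬p₀ with least {P ∘ suc} (P? ∘ suc) pm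
... | k , (pk , min) , k≤m = suc k , (pk , min′) , s≤s k≤m
  where
  min′ : ∀ j → P j → suc k ≤ j
  min′ zero    p₀ = contradiction p₀ ¬p₀
  min′ (suc j) pj = s≤s (min j pj)

-- Functions are enumerated by codes in a finite type; decoding returns them only pointwise, whence
-- the closure of `P` under `≗`.
any-function? : ∀ {n k} {P : Pred (Fin n → Fin k) 0ℓ} → Decidable P →
                (∀ {f g} → f ≗ g → P f → P g) → Dec (∃ P)
any-function? P? resp =
  map′ (λ (i , p) → finToFun i , p)
       (λ (f , p) → funToFin f , resp (≡-sym ∘ finToFun-funToFin f) p)
       (any? (P? ∘ finToFun))

-- Matching on `suc _` gives `punchOut` the successor size it needs, a form that `2 ^ k` does not
-- reduce to; `Fin zero` has no elements to treat.
omit : ∀ {m} (i j : Fin m) → i ≢ j → Fin (m ∸ 1)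
omit {suc _} _ _ = punchOut

omit-injective : ∀ {m} {i j l : Fin m} (i≢j : i ≢ j) (i≢l : i ≢ l) →
                 omit i j i≢j ≡ omit i l i≢l → j ≡ l
omit-injective {suc _} = punchOut-injective

indicator : {A : Set} → Dec A → Fin 2
indicator (yes _) = suc zero
indicator (no _)  = zero

indicator-≡⇒→ : {A B : Set} (a? : Dec A) (b? : Dec B) →
                      indicator a? ≡ indicator b? → A → B
indicator-≡⇒→ _        (yes b) _  _ = b
indicator-≡⇒→ (no ¬a)  (no _)  _  a = contradiction a ¬a

code : ∀ {k} {P : Pred (Fin k) 0ℓ} → Decidable P → Fin (2 ^ k)
code P? = funToFin (indicator ∘ P?)

code-≡⇒⊆ : ∀ {k} {P Q : Pred (Fin k) 0ℓ} (P? : Decidable P) (Q? : Decidable Q) →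
                 code P? ≡ code Q? → P ⊆ Q
code-≡⇒⊆ P? Q? eq {α} = indicator-≡⇒→ (P? α) (Q? α) (begin
  indicator (P? α)     ≡⟨ finToFun-funToFin (indicator ∘ P?) α ⟨
  finToFun (code P?) α ≡⟨ cong (λ i → finToFun i α) eq ⟩
  finToFun (code Q?) α ≡⟨ finToFun-funToFin (indicator ∘ Q?) α ⟩
  indicator (Q? α)     ∎)
  where open ≡-Reasoning

-- Star forests

Searchable : Set → Set₁
Searchable V = {P : Pred V 0ℓ} → Decidable P → Dec (∃ P)

-- Membership proofs are irrelevant, so each `u` in `S` carries just one element to test.
any-refinement? : ∀ {n} {S : Pred (Fin n) 0ℓ} → Decidable S → Searchable (Refinement (Fin n) S)
any-refinement? {n} {S} S? {P} P? =
  map′ (λ (u , x , _ , px) → x , px) (λ (x , px) → value x , x , refl , px) (any? at?)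
  where
  at? : ∀ u → Dec (∃[ x ] (value x ≡ u × P x))
  at? u with S? u
  ... | no ¬s = no λ { ((_ , ⟦ s ⟧) , refl , _) → ⊥-elim-irr (¬s s) }
  ... | yes s = map′ (λ p → (u , ⟦ s ⟧) , refl , p) (λ { (_ , refl , p) → p }) (P? (u , ⟦ s ⟧))

-- Since `a ≡ d` is allowed, triangles are excluded as well as paths on four vertices.
Walks₃Backtrack : {V : Set} → Graph V → Set
Walks₃Backtrack G = ∀ {a b c d} → a ~ b → b ~ c → c ~ d → a ≡ c ⊎ b ≡ d
  where open Graph G

module _ {V : Set} (G : Graph V) where
  open Graph G

  ~⇒≢ : ∀ {u v} → u ~ v → u ≢ v
  ~⇒≢ u~v u≡v = irrefl u≡v u~v

  -- All four vertices lie in the component of `a`, where each edge has exactly one end at the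
  -- centre. So the centre is both `a` and `c`, or both `b` and `d`.
  starForest⇒walks₃Backtrack : IsStarForest G → Walks₃Backtrack G
  starForest⇒walks₃Backtrack forest {a} {b} {c} {d} a~b b~c c~d = cases
    (to (star A B) a~b) (to (star B C) b~c) (to (star C D) c~d)
    where
    open Equivalence using (to)
    W : Set
    W = Refinement V (Reachable G a)
    A B C D : W
    A = a , ⟦ ε ⟧
    B = b , ⟦ a~b ◅ ε ⟧
    C = c , ⟦ a~b ◅ b~c ◅ ε ⟧
    D = d , ⟦ a~b ◅ b~c ◅ c~d ◅ ε ⟧
    centre : W
    centre = proj₁ (forest a)
    star = proj₂ (forest a)
    Spoke : W → W → Set
    Spoke x y = (x ≡ centre × y ≢ centre) ⊎ (x ≢ centre × y ≡ centre)
    cases : Spoke A B → Spoke B C → Spoke C D → a ≡ c ⊎ b ≡ d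
    cases (inj₁ (_   , b≢z)) (inj₁ (b≡z , _))   _                  = contradiction b≡z b≢z
    cases (inj₁ (a≡z , _))   (inj₂ (_ , c≡z))   _                  = inj₁ (cong value (trans a≡z (≡-sym c≡z)))
    cases (inj₂ (_ , b≡z))   (inj₂ (b≢z , _))   _                  = contradiction b≡z b≢z
    cases (inj₂ _)           (inj₁ (_ , c≢z))   (inj₁ (c≡z , _))   = contradiction c≡z c≢z
    cases (inj₂ (_ , b≡z))   (inj₁ _)           (inj₂ (_ , d≡z))   = inj₂ (cong value (trans b≡z (≡-sym d≡z)))

  module _ (_≟ⱽ_ : DecidableEquality V) (search : Searchable V) (backtrack : Walks₃Backtrack G) where

    IsCentre : V → Set
    IsCentre z = ∀ {x y} → z ~ x → x ~ y → y ≡ z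

    -- Walks from `z` never leave `Near`, so the component consists of `z` and its neighbours, and
    -- `IsCentre` forbids edges between neighbours.
    centreStar : ∀ {v z} → Reachable G v z → Reachable G z v → IsCentre z → IsStar (component G v)
    centreStar {v} {z} v⇝z z⇝v isCentre = Z , λ x y → mk⇔ (to x y) (from x y)
      where
      W : Set
      W = Refinement V (Reachable G v)
      Z : W
      Z = z , ⟦ v⇝z ⟧

      Near : V → Set
      Near x = x ≡ z ⊎ z ~ x

      near-closed : ∀ {x y} → Near x → Reachable G x y → Near y
      near-closed near        ε           = near
      near-closed (inj₁ refl) (z~x ◅ x⇝y) = near-closed (inj₂ z~x) x⇝y
      near-closed (inj₂ z~w)  (w~x ◅ x⇝y) = near-closed (inj₁ (isCentre z~w w~x)) x⇝y

      v-near : Near v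
      v-near = near-closed (inj₁ refl) z⇝v

      adjacent : (x : W) → value x ≢ z → z ~ value x
      adjacent (x , ⟦ v⇝x ⟧) x≢z =
        fromInj₂ (λ x≡z → contradiction x≡z x≢z)
          -- Reachability of `x` is available only irrelevantly, so the decidable conclusion is
          -- recomputed.
          (recompute ((x ≟ⱽ z) ⊎-dec (z ~? x)) (near-closed v-near v⇝x))

      to : (x y : W) → value x ~ value y → (x ≡ Z × y ≢ Z) ⊎ (x ≢ Z × y ≡ Z)
      to x y x~y with value x ≟ⱽ z
      ... | yes x≡z = inj₁ (value-injective x≡z ,
                            λ y≡Z → ~⇒≢ x~y (trans x≡z (≡-sym (cong value y≡Z))))
      ... | no x≢z  = inj₂ (x≢z ∘ cong value , value-injective (isCentre (adjacent x x≢z) x~y))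

      from : (x y : W) → (x ≡ Z × y ≢ Z) ⊎ (x ≢ Z × y ≡ Z) → value x ~ value y
      from _ y (inj₁ (refl , y≢Z)) = adjacent y (y≢Z ∘ value-injective)
      from x _ (inj₂ (x≢Z , refl)) = sym (adjacent x (x≢Z ∘ value-injective))

    -- The centre is the middle vertex of a walk `v`, `u`, `y` with `y ≢ v` if there is one, and `v`
    -- otherwise.
    walks₃Backtrack⇒starForest : IsStarForest G
    walks₃Backtrack⇒starForest v
      with search (λ u → search (λ y → (v ~? u) ×-dec ((u ~? y) ×-dec ¬? (y ≟ⱽ v))))
    ... | yes (u , y , v~u , u~y , y≢v) = centreStar (v~u ◅ ε) (sym v~u ◅ ε) isCentre
      where
      isCentre : IsCentre u
      isCentre u~x x~w with backtrack v~u u~x x~w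
      ... | inj₂ u≡w  = ≡-sym u≡w
      -- Now `x` is `v`, and the walk `y`, `u`, `v`, `w` settles the case since `y ≢ v`.
      ... | inj₁ refl = fromInj₂ (λ y≡v → contradiction y≡v y≢v)
                          (map₂ ≡-sym (backtrack (sym u~y) u~x x~w))
    ... | no none = centreStar ε ε isCentre
      where
      isCentre : IsCentre v
      isCentre {x} {y} v~x x~y with y ≟ⱽ v
      ... | yes y≡v = y≡v
      ... | no y≢v  = contradiction (x , y , v~x , x~y , y≢v) none

module _ {n : ℕ} (G : Graph (Fin n)) where
  open Graph G

  -- Star colourings

  BicolouredWalks₃Backtrack : ∀ {k} → (Fin n → Fin k) → Set
  BicolouredWalks₃Backtrack f =
    ∀ a b c d → a ~ b → b ~ c → c ~ d → f a ≡ f c → f b ≡ f d → a ≡ c ⊎ b ≡ d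

  starColouring⇒bicolouredWalks₃Backtrack : ∀ {k} {f : Fin n → Fin k} →
    IsStarColoring G f → BicolouredWalks₃Backtrack f
  starColouring⇒bicolouredWalks₃Backtrack {f = f} (proper , forests) a b c d a~b b~c c~d fa≡fc fb≡fd =
    map (cong value) (cong value)
      (starForest⇒walks₃Backtrack (G [ _ ]) (forests (f a) (f b) (proper a~b))
        {a , ⟦ inj₁ refl ⟧} {b , ⟦ inj₂ refl ⟧} {c , ⟦ inj₁ (≡-sym fa≡fc) ⟧} {d , ⟦ inj₂ (≡-sym fb≡fd) ⟧}
        a~b b~c c~d)

  bicolouredWalks₃Backtrack⇒starColouring : ∀ {k} {f : Fin n → Fin k} →
    IsProperColoring G f → BicolouredWalks₃Backtrack f → IsStarColoring G f
  bicolouredWalks₃Backtrack⇒starColouring {k} {f} proper backtrack =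
    proper , λ i j _ → walks₃Backtrack⇒starForest (G [ InClass i j ]) (≟-refinement _≟_)
      (any-refinement? (inClass? i j)) (backtrackIn i j)
    where
    InClass : Fin k → Fin k → Fin n → Set
    InClass i j v = f v ≡ i ⊎ f v ≡ j

    inClass? : ∀ i j → Decidable (InClass i j)
    inClass? i j v = (f v ≟ i) ⊎-dec (f v ≟ j)

    -- By properness `u` and `w` both avoid the colour of `v`, so both have the other colour.
    alternate : ∀ {i j u v w} → InClass i j u → InClass i j v → InClass i j w →
                u ~ v → v ~ w → f u ≡ f w
    alternate (inj₁ u) (inj₁ v) _        u~v _   = contradiction (trans u (≡-sym v)) (proper u~v)
    alternate (inj₁ u) (inj₂ _) (inj₁ w) _   _   = trans u (≡-sym w)
    alternate (inj₁ _) (inj₂ v) (inj₂ w) _   v~w = contradiction (trans v (≡-sym w)) (proper v~w)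
    alternate (inj₂ u) (inj₂ v) _        u~v _   = contradiction (trans u (≡-sym v)) (proper u~v)
    alternate (inj₂ u) (inj₁ _) (inj₂ w) _   _   = trans u (≡-sym w)
    alternate (inj₂ _) (inj₁ v) (inj₁ w) _   v~w = contradiction (trans v (≡-sym w)) (proper v~w)

    backtrackIn : ∀ i j → Walks₃Backtrack (G [ InClass i j ])
    backtrackIn i j {a , ⟦ a∈ ⟧} {b , ⟦ b∈ ⟧} {c , ⟦ c∈ ⟧} {d , ⟦ d∈ ⟧} a~b b~c c~d =
      map value-injective value-injective
        (backtrack a b c d a~b b~c c~d
          (recompute (f a ≟ f c) (alternate a∈ b∈ c∈ a~b b~c))
          (recompute (f b ≟ f d) (alternate b∈ c∈ d∈ b~c c~d)))

  starColouring? : ∀ {k} → Decidable (IsStarColoring G {k})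
  starColouring? f =
    map′ (λ (proper , backtrack) →
            bicolouredWalks₃Backtrack⇒starColouring (λ {u} {v} → proper u v) backtrack)
         (λ isStar → (λ u v → proj₁ isStar {u} {v}) , starColouring⇒bicolouredWalks₃Backtrack isStar)
         (all? (λ u → all? λ v → (u ~? v) →-dec ¬? (f u ≟ f v))
           ×-dec
          all? (λ a → all? λ b → all? λ c → all? λ d →
            (a ~? b) →-dec ((b ~? c) →-dec ((c ~? d) →-dec
            ((f a ≟ f c) →-dec ((f b ≟ f d) →-dec ((a ≟ c) ⊎-dec (b ≟ d))))))))

  starColouring-resp-≗ : ∀ {k} {f g : Fin n → Fin k} → f ≗ g → IsStarColoring G f → IsStarColoring G g
  starColouring-resp-≗ f≗g isStar = bicolouredWalks₃Backtrack⇒starColouring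
    (λ {u} {v} u~v gu≡gv → proj₁ isStar u~v (pull u v gu≡gv))
    (λ a b c d a~b b~c c~d ga≡gc gb≡gd →
      starColouring⇒bicolouredWalks₃Backtrack isStar a b c d a~b b~c c~d
        (pull a c ga≡gc) (pull b d gb≡gd))
    where
    pull = λ u v gu≡gv → trans (f≗g u) (trans gu≡gv (≡-sym (f≗g v)))

  starColorable? : Decidable (StarColorable G)
  starColorable? k = any-function? starColouring? starColouring-resp-≗

  -- Edges and incident colours

  joins⇒~ : ∀ e {u v} → Joins G e u v → u ~ v
  joins⇒~ (edge s t _ s~t) (inj₁ (refl , refl)) = recompute (s ~? t) s~t
  joins⇒~ (edge s t _ s~t) (inj₂ (refl , refl)) = sym (recompute (s ~? t) s~t)

  joins⇒≢ : ∀ e {u v} → Joins G e u v → u ≢ v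
  joins⇒≢ e = ~⇒≢ G ∘ joins⇒~ e

  -- `src<tgt` fixes the orientation, and irrelevance of the proof fields identifies edges with
  -- equal endpoints.
  joins-unique : ∀ e e′ {u v} → Joins G e u v → Joins G e′ u v → e ≡ e′
  joins-unique _ _ (inj₁ (refl , refl)) (inj₁ (refl , refl)) = refl
  joins-unique _ _ (inj₂ (refl , refl)) (inj₂ (refl , refl)) = refl
  joins-unique (edge _ _ s<t _) (edge _ _ t<s _) (inj₁ (refl , refl)) (inj₂ (refl , refl)) =
    ⊥-elim-irr (<-asym s<t t<s)
  joins-unique (edge _ _ s<t _) (edge _ _ t<s _) (inj₂ (refl , refl)) (inj₁ (refl , refl)) =
    ⊥-elim-irr (<-asym s<t t<s)

  edgeBetween : ∀ {u v} → u ~ v → ∃[ e ] Joins G e u v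
  edgeBetween {u} {v} u~v with <-cmp u v
  ... | tri< u<v _ _ = edge u v u<v u~v , inj₁ (refl , refl)
  ... | tri≈ _ u≡v _ = contradiction u~v (irrefl u≡v)
  ... | tri> _ _ v<u = edge v u v<u (sym u~v) , inj₂ (refl , refl)

  module _ {k : ℕ} (c : Edge G → Fin k) where

    Sees : Fin n → Pred (Fin k) 0ℓ
    Sees v α = ∃[ w ] ∃[ e ] (Joins G e v w × c e ≡ α)

    sees? : ∀ v → Decidable (Sees v)
    sees? v α = any? via?
      where
      via? : ∀ w → Dec (∃[ e ] (Joins G e v w × c e ≡ α))
      via? w with v ~? w
      ... | no v≁w = no λ (e , j , _) → v≁w (joins⇒~ e j)
      -- By `joins-unique` the edge `e` is the only candidate.
      ... | yes v~w = let e , j = edgeBetween v~w in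
        map′ (λ ce≡α → e , j , ce≡α)
             (λ (e′ , j′ , ce′≡α) → trans (cong c (joins-unique e e′ j j′)) ce′≡α)
             (c e ≟ α)

    module _ (injective : IsInjectiveEdgeColoring G c) where

      -- The walk is a triangle if `w ≡ x` and a path otherwise, so one of the two constructors of
      -- `Consecutive` applies.
      outer-differ : ∀ e₁ e₂ e₃ {w u v x} → Joins G e₁ w u → Joins G e₂ u v → Joins G e₃ v x →
                     w ≢ v → u ≢ x → c e₁ ≢ c e₃
      outer-differ e₁ e₂ e₃ {w = w} {x = x} j₁ j₂ j₃ w≢v u≢x with w ≟ x
      ... | yes refl = injective {e₁} {e₂} {e₃} (cycle (joins⇒≢ e₁ j₁) (joins⇒≢ e₂ j₂) (joins⇒≢ e₃ j₃) j₁ j₂ j₃)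
      ... | no w≢x   = injective {e₁} {e₂} {e₃}
                         (path (joins⇒≢ e₁ j₁) w≢v w≢x (joins⇒≢ e₂ j₂) u≢x (joins⇒≢ e₃ j₃) j₁ j₂ j₃)

      -- If `v` saw the colour of `e′` on an edge other than `e`, that edge and `e′` would be the
      -- equally coloured outer edges of a walk `w`, `u`, `v`, `x`.
      seen-across : ∀ e e′ {u v w} → Joins G e u v → Joins G e′ u w → w ≢ v →
                    Sees v (c e′) → c e′ ≡ c e
      seen-across e e′ {u = u} j j′ w≢v (x , e″ , j″ , ce″≡ce′) with u ≟ x
      ... | yes refl = trans (≡-sym ce″≡ce′) (cong c (joins-unique e″ e j″ (swap j)))
      ... | no u≢x   = contradiction (≡-sym ce″≡ce′)
                         (outer-differ e′ e e″ (swap j′) j j″ w≢v u≢x)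

      same-colours⇒walks₃Backtrack : ∀ {a b d f} → a ~ b → b ~ d → d ~ f →
        Sees d ⊆ Sees a → Sees f ⊆ Sees b → a ≡ d ⊎ b ≡ f
      same-colours⇒walks₃Backtrack {a} {b} {d} {f} a~b b~d d~f d⊆a f⊆b with a ≟ d | b ≟ f
      ... | yes a≡d | _       = inj₁ a≡d
      ... | no _    | yes b≡f = inj₂ b≡f
      ... | no a≢d  | no b≢f  = contradiction cr≡cq cr≢cq
        where
        p = proj₁ (edgeBetween a~b)
        q = proj₁ (edgeBetween b~d)
        r = proj₁ (edgeBetween d~f)
        jp = proj₂ (edgeBetween a~b)
        jq = proj₂ (edgeBetween b~d)
        jr = proj₂ (edgeBetween d~f)

        cr≡cq : c r ≡ c q
        -- `b` sees the colour of `r` because `f` does; across `q` this forces the colour of `q`.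
        cr≡cq = seen-across q r (swap jq) jr (≢-sym b≢f) (f⊆b (d , r , swap jr , refl))

        cr≢cq : c r ≢ c q
        -- Since `d` sees the colour of `r`, so does `a`, on some edge `s`. If `s` is `p`, the walk
        -- `a`, `b`, `d`, `f` gives a contradiction; otherwise the walk `x`, `a`, `b`, `d` does, as
        -- `q` and `r` share a colour.
        cr≢cq cr≡cq with d⊆a (f , r , jr , refl)
        ... | x , s , js , cs≡cr with x ≟ b
        ...   | yes refl = outer-differ p q r jp jq jr a≢d b≢f
                             (trans (cong c (joins-unique p s jp js)) cs≡cr)
        ...   | no x≢b   = outer-differ s p q (swap js) jp jq x≢b a≢d (trans cs≡cr cr≡cq)

  -- Minimum degree at least two

  -- Of two distinct neighbours of `v`, at least one differs from `w`.
  another-neighbour : MinDegreeAtLeast G 2 → ∀ v w → ∃[ x ] (v ~ x × x ≢ w)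
  another-neighbour deg v w =
    pick (deg v) (all-filter (v ~?_) (allFin n)) (filter⁺ (v ~?_) (allFin⁺ n))
    where
    pick : ∀ {xs : List (Fin n)} → 2 ≤ length xs → All (v ~_) xs → Unique xs → ∃[ x ] (v ~ x × x ≢ w)
    pick {x ∷ y ∷ _} _ (v~x ∷ v~y ∷ _) ((x≢y ∷ _) ∷ _) with x ≟ w
    ... | yes refl = y , v~y , ≢-sym x≢y
    ... | no x≢w   = x , v~x , x≢w
    pick {_ ∷ []} (s≤s ()) _ _

  module _ (deg : MinDegreeAtLeast G 2) {k : ℕ} (c : Edge G → Fin k)
           (injective : IsInjectiveEdgeColoring G c) where

    sees-some : ∀ v → ∃ (Sees c v)
    -- Any neighbour will do; `v` is an arbitrary choice of vertex to avoid.
    sees-some v with another-neighbour deg v v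
    ... | w , v~w , _ = let e , j = edgeBetween v~w in c e , w , e , j , refl

    -- With equal sets, the further edges `e₁` at `u` and `e₃` at `v` would both have the colour of
    -- `e`, yet they are the outer edges of the walk `w`, `u`, `v`, `x`.
    adjacent-sees-differ : ∀ {u v} → u ~ v → Sees c u ⊆ Sees c v → ¬ (Sees c v ⊆ Sees c u)
    adjacent-sees-differ {u} {v} u~v u⊆v v⊆u
      with edgeBetween u~v | another-neighbour deg u v | another-neighbour deg v u
    ... | e , j | w , u~w , w≢v | x , v~x , x≢u with edgeBetween u~w | edgeBetween v~x
    ...   | e₁ , j₁ | e₃ , j₃ =
      outer-differ c injective e₁ e e₃ (swap j₁) j j₃ w≢v (≢-sym x≢u)
        (trans (seen-across c injective e e₁ j j₁ w≢v (u⊆v (w , e₁ , j₁ , refl)))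
               (≡-sym (seen-across c injective e e₃ (swap j) j₃ x≢u (v⊆u (x , e₃ , j₃ , refl)))))

    code-sees≢code-∅ : ∀ v → code {k} ∅? ≢ code (sees? c v)
    code-sees≢code-∅ v eq with code-≡⇒⊆ (sees? c v) ∅? (≡-sym eq) (proj₂ (sees-some v))
    ... | ()

    -- Dropping the code of the empty set, which no vertex has, saves one colour.
    colour : Fin n → Fin (2 ^ k ∸ 1)
    colour v = omit (code {k} ∅?) (code (sees? c v)) (code-sees≢code-∅ v)

    colour-≡⇒sees-⊆ : ∀ u v → colour u ≡ colour v → Sees c u ⊆ Sees c v
    colour-≡⇒sees-⊆ u v eq = code-≡⇒⊆ (sees? c u) (sees? c v)
      (omit-injective (code-sees≢code-∅ u) (code-sees≢code-∅ v) eq)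

    colour-isStarColouring : IsStarColoring G colour
    colour-isStarColouring = bicolouredWalks₃Backtrack⇒starColouring
      (λ {u} {v} u~v eq → adjacent-sees-differ u~v
        (colour-≡⇒sees-⊆ u v eq) (colour-≡⇒sees-⊆ v u (≡-sym eq)))
      (λ a b d f a~b b~d d~f a≡d b≡f → same-colours⇒walks₃Backtrack c injective a~b b~d d~f
        (colour-≡⇒sees-⊆ d a (≡-sym a≡d)) (colour-≡⇒sees-⊆ f b (≡-sym b≡f)))

mainTheorem7 : ∀ {n : ℕ} (G : Graph (Fin n)) → MinDegreeAtLeast G 2 →
    ∀ (k : ℕ) → IsInjectiveChromaticIndex G k →
    ∃[ m ] (IsStarChromaticNumber G m × m ≤ 2 ^ k ∸ 1)
mainTheorem7 G deg k ((c , injective) , _) =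
  -- The colouring with `2 ^ k ∸ 1` colours is the witness that both ends the search for the star
  -- chromatic number and bounds it.
  least (starColorable? G) (colour G deg c injective , colour-isStarColouring G deg c injective)
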